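{- There is an absolute constant $\alpha>0$ such that for every integer $k>5$ there exists a $k$-terminal network $(G,c)$ such that every mimicking network $(G',c')$ of $(G,c)$ satisfies $|V(G')|\ge 2^{\alpha k}$. Moreover, $G$ can be taken to be bipartite with all the terminals on one side of the bipartition and all the non-terminals on the other side.
   Context: A network $(G,c)$ is an undirected graph $G$ with edge costs $c:E(G)\to\mathbb{R}^+$; its size is $|V(G)|$. A $k$-terminal network additionally has a set $Q=\{q_1,\dots,q_k\}\subseteq V(G)$ of distinguished vertices called terminals. For $S\subset Q$ with $S\neq\emptyset,Q$, write $\bar S=Q\setminus S$; a cut $(W,V(G)\setminus W)$ is $S$-separating if $W\cap Q\in\{S,\bar S\}$. The cost of a cut is the total cost of the edges with exactly one endpoint in $W$ (the cutset). $\mathrm{mincut}_{G,c}(S,\bar S)$ denotes the minimum cost of an $S$-separating cut. A mimicking network of a $k$-terminal network $(G,c)$ is a $k$-terminal network $(G',c')$ with the same terminal set $Q$ such that $\mathrm{mincut}_{G',c'}(S,\bar S)=\mathrm{mincut}_{G,c}(S,\bar S)$ for every $S\subset Q$ with $S\neq\emptyset,Q$. -}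

module Defs where

open import Data.Bool.Base using (Bool; true; false; if_then_else_; _xor_)
import Data.Bool.Properties as Bool
open import Data.Fin.Base using (Fin)
import Data.Fin.Base as Fin
open import Data.Fin.Properties using (any?) renaming (_≟_ to _≟ᶠ_)
open import Data.Fin.Subset using (Subset; Nonempty; _∈_; ∁; inside; outside)
open import Data.Fin.Subset.Properties using (_∈?_)
open import Data.Integer.Base using (+_; -[1+_])
open import Data.List.Base using (List; []; _∷_; _++_; map; filter; foldr)
open import Data.Nat.Base using (ℕ; zero; suc)
import Data.Nat.Base as ℕ
import Data.Nat.Properties as ℕ
open import Data.Product.Base using (∃-syntax; _×_; _,_)
open import Data.Rational.Base
  using (ℚ; mkℚ; 0ℚ; ½; _+_; _-_; -_; _*_; ∣_∣; _⊓_; _<_; _≤_)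
import Data.Rational.Properties as ℚ
open import Data.Rational.Solver using (module +-*-Solver)
open import Data.Sum.Base using (_⊎_; inj₁; inj₂)
open import Data.Vec.Base using ([]; _∷_; lookup; tabulate)
import Data.Vec.Properties as Vec
import Data.Vec.Functional as Vector
open import Function.Definitions using (Injective)
open import Relation.Binary.PropositionalEquality
open import Relation.Nullary using (Dec; does; ¬_; contradiction)
open import Relation.Nullary.Decidable using (_×-dec_; _⊎-dec_; dec-true; dec-false)

------------------------------------------------------------------------
-- Real numbers: Cauchy sequences of rationals, compared up to _≃_.

Eventually : (ℕ → Set) → Set
Eventually P = ∃[ N ] ∀ n → N ℕ.≤ n → P n

IsCauchy : (ℕ → ℚ) → Set
IsCauchy x = ∀ ε → 0ℚ < ε →
  ∃[ N ] ∀ m n → N ℕ.≤ m → N ℕ.≤ n → ∣ x m - x n ∣ < ε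

record ℝ : Set where
  constructor mkℝ
  field
    seq    : ℕ → ℚ
    cauchy : IsCauchy seq

open ℝ public

infix 4 _≃_ _≤ᴿ_ _<ᴿ_

_≃_ _≤ᴿ_ _<ᴿ_ : ℝ → ℝ → Set
x ≃ y  = ∀ ε → 0ℚ < ε → Eventually λ n → ∣ seq x n - seq y n ∣ < ε
x ≤ᴿ y = ∀ ε → 0ℚ < ε → Eventually λ n → seq x n ≤ seq y n + ε
x <ᴿ y = ∃[ ε ] 0ℚ < ε × Eventually λ n → seq x n + ε ≤ seq y n

fromℚ : ℚ → ℝ
fromℚ q = mkℝ (λ _ → q) λ ε 0<ε → 0 , λ _ _ _ _ →
  subst (_< ε) (sym (cong ∣_∣ (ℚ.+-inverseʳ q))) 0<ε

0ᴿ : ℝ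
0ᴿ = fromℚ 0ℚ

private
  p≤∣p∣ : ∀ p → p ≤ ∣ p ∣
  p≤∣p∣ p with ℚ.≤-total 0ℚ p
  ... | inj₁ 0≤p = ℚ.≤-reflexive (sym (ℚ.0≤p⇒∣p∣≡p 0≤p))
  ... | inj₂ p≤0 = ℚ.≤-trans p≤0 (ℚ.0≤∣p∣ p)

  ∣-∣<⇒< : ∀ {p q ε} → ∣ p - q ∣ < ε → p < q + ε
  ∣-∣<⇒< {p} {q} {ε} h = subst (_< q + ε)
    (solve 2 (λ p q → q :+ (p :- q) := p) refl p q)
    (ℚ.+-monoʳ-< q (ℚ.≤-<-trans (p≤∣p∣ (p - q)) h))
    where open +-*-Solver

  ∣-∣-comm : ∀ p q → ∣ p - q ∣ ≡ ∣ q - p ∣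
  ∣-∣-comm p q = trans (sym (ℚ.∣-p∣≡∣p∣ (p - q)))
    (cong ∣_∣ (solve 2 (λ p q → :- (p :- q) := q :- p) refl p q))
    where open +-*-Solver

  <⇒-< : ∀ {p q ε} → p < q + ε → p - q < ε
  <⇒-< {p} {q} {ε} h = subst (p - q <_)
    (solve 2 (λ q ε → q :+ ε :- q := ε) refl q ε)
    (ℚ.+-monoˡ-< (- q) h)
    where open +-*-Solver

  <⇒∣-∣< : ∀ {p q ε} → p < q + ε → q < p + ε → ∣ p - q ∣ < ε
  <⇒∣-∣< {p} {q} {ε} h k with ℚ.∣p∣≡p∨∣p∣≡-p (p - q)
  ... | inj₁ e = subst (_< ε) (sym e) (<⇒-< h)
  ... | inj₂ e = subst (_< ε)
    (sym (trans e (solve 2 (λ p q → :- (p :- q) := q :- p) refl p q))) (<⇒-< k)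
    where open +-*-Solver

  ⊓-< : ∀ {a b c d ε} → a < c + ε → b < d + ε → a ⊓ b < (c ⊓ d) + ε
  ⊓-< {a} {b} {c} {d} {ε} h k with ℚ.⊓-sel c d
  ... | inj₁ e = subst (λ z → a ⊓ b < z + ε) (sym e) (ℚ.≤-<-trans (ℚ.p⊓q≤p a b) h)
  ... | inj₂ e = subst (λ z → a ⊓ b < z + ε) (sym e) (ℚ.≤-<-trans (ℚ.p⊓q≤q a b) k)

  ½*-pos : ∀ {ε} → 0ℚ < ε → 0ℚ < ½ * ε
  ½*-pos {ε} h = subst (_< ½ * ε) (ℚ.*-zeroʳ ½) (ℚ.*-monoʳ-<-pos ½ h)

  ½+½ : ∀ ε → ½ * ε + ½ * ε ≡ ε
  ½+½ ε = trans (sym (ℚ.*-distribʳ-+ ε ½ ½)) (ℚ.*-identityˡ ε)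

  +-cauchy : ∀ {x y} → IsCauchy x → IsCauchy y → IsCauchy (λ n → x n + y n)
  +-cauchy {x} {y} cx cy ε 0<ε
    with cx (½ * ε) (½*-pos 0<ε) | cy (½ * ε) (½*-pos 0<ε)
  ... | M , hx | N , hy = M ℕ.⊔ N , λ m n m≥ n≥ →
    subst₂ _<_ refl (½+½ ε)
      (ℚ.≤-<-trans
        (subst (λ z → ∣ z ∣ ≤ ∣ x m - x n ∣ + ∣ y m - y n ∣)
          (solve 4 (λ a b c d → (a :- b) :+ (c :- d) := (a :+ c) :- (b :+ d))
            refl (x m) (x n) (y m) (y n))
          (ℚ.∣p+q∣≤∣p∣+∣q∣ (x m - x n) (y m - y n)))
        (ℚ.+-mono-<
          (hx m n (ℕ.m⊔n≤o⇒m≤o M N m≥) (ℕ.m⊔n≤o⇒m≤o M N n≥))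
          (hy m n (ℕ.m⊔n≤o⇒n≤o M N m≥) (ℕ.m⊔n≤o⇒n≤o M N n≥))))
    where open +-*-Solver

  ⊓-cauchy : ∀ {x y} → IsCauchy x → IsCauchy y → IsCauchy (λ n → x n ⊓ y n)
  ⊓-cauchy {x} {y} cx cy ε 0<ε with cx ε 0<ε | cy ε 0<ε
  ... | M , hx | N , hy = M ℕ.⊔ N , λ m n m≥ n≥ →
    <⇒∣-∣< (below m n m≥ n≥) (below n m n≥ m≥)
    where
    below : ∀ m n → M ℕ.⊔ N ℕ.≤ m → M ℕ.⊔ N ℕ.≤ n → x m ⊓ y m < (x n ⊓ y n) + ε
    below m n m≥ n≥ = ⊓-<
      {x m} {y m} {x n} {y n}
      (∣-∣<⇒< {x m} {x n} (hx m n (ℕ.m⊔n≤o⇒m≤o M N m≥) (ℕ.m⊔n≤o⇒m≤o M N n≥)))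
      (∣-∣<⇒< {y m} {y n} (hy m n (ℕ.m⊔n≤o⇒n≤o M N m≥) (ℕ.m⊔n≤o⇒n≤o M N n≥)))

infixl 6 _+ᴿ_
infixl 7 _⊓ᴿ_ _·ᴿ_

_+ᴿ_ : ℝ → ℝ → ℝ
x +ᴿ y = mkℝ (λ n → seq x n + seq y n) (+-cauchy {seq x} {seq y} (cauchy x) (cauchy y))

_⊓ᴿ_ : ℝ → ℝ → ℝ
x ⊓ᴿ y = mkℝ (λ n → seq x n ⊓ seq y n) (⊓-cauchy {seq x} {seq y} (cauchy x) (cauchy y))

∑ : ∀ {n} → (Fin n → ℝ) → ℝ
∑ = Vector.foldr _+ᴿ_ 0ᴿ

_·ᴿ_ : ℕ → ℝ → ℝ
k ·ᴿ x = ∑ {k} (λ _ → x)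

-- For a rational r = p / q the inequality 2^(p/q) ≤ N means 2^p ≤ N^q
-- (negative powers of 2 are moved to the right-hand side).
PowTwoℚ≤ : ℚ → ℕ → Set
PowTwoℚ≤ (mkℚ (+ p)      q-1 _) N = 2 ℕ.^ p ℕ.≤ N ℕ.^ suc q-1
PowTwoℚ≤ (mkℚ -[1+ p-1 ] q-1 _) N = 1 ℕ.≤ 2 ℕ.^ suc p-1 ℕ.* N ℕ.^ suc q-1

-- The inequality 2^x ≤ N for real x, where 2^x is by definition the
-- supremum of 2^r over the rationals r ≤ x.
PowTwo≤ : ℝ → ℕ → Set
PowTwo≤ x N = ∀ r → fromℚ r ≤ᴿ x → PowTwoℚ≤ r N

------------------------------------------------------------------------
-- Networks

-- Finite simple undirected graphs.  The unordered pair of endpoints of an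
-- edge is stored in increasing order, which also excludes loops.
record Graph : Set where
  field
    ∣V∣ ∣E∣ : ℕ
    src tgt : Fin ∣E∣ → Fin ∣V∣
    src<tgt : ∀ e → src e Fin.< tgt e
    simple  : ∀ {e f} → src e ≡ src f → tgt e ≡ tgt f → e ≡ f

-- A k-terminal network.  The terminal set Q is identified with Fin k, and
-- term embeds it into the vertices; two k-terminal networks thus share the
-- same labelled terminals.
record Network (k : ℕ) : Set where
  field
    graph    : Graph
  open Graph graph public
  field
    cost     : Fin ∣E∣ → ℝ
    cost-pos : ∀ e → 0ᴿ <ᴿ cost e
    term     : Fin k → Fin ∣V∣
    term-inj : Injective _≡_ _≡_ term

  Cut : Set
  Cut = Subset ∣V∣

  Crosses : Cut → Fin ∣E∣ → Bool
  Crosses W e = lookup W (src e) xor lookup W (tgt e)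

  cutCost : Cut → ℝ
  cutCost W = ∑ λ e → if Crosses W e then cost e else 0ᴿ

  -- W ∩ Q, as a subset of Q
  trace : Cut → Subset k
  trace W = tabulate λ i → lookup W (term i)

  Separates : Subset k → Cut → Set
  Separates S W = trace W ≡ S ⊎ trace W ≡ ∁ S

  separates? : ∀ S W → Dec (Separates S W)
  separates? S W = (trace W ≟ S) ⊎-dec (trace W ≟ ∁ S)
    where _≟_ = Vec.≡-dec Bool._≟_

  IsTerminal : Fin ∣V∣ → Set
  IsTerminal v = ∃[ i ] term i ≡ v

  -- The cut W with W = S, witnessing that S-separating cuts exist.
  inS? : ∀ S v → Dec (∃[ i ] i ∈ S × term i ≡ v)
  inS? S v = any? λ i → (i ∈? S) ×-dec (term i ≟ᶠ v)

  terminalCut : Subset k → Cut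
  terminalCut S = tabulate λ v → does (inS? S v)

  terminalCut-separates : ∀ S → Separates S (terminalCut S)
  terminalCut-separates S = inj₁ (trans (Vec.tabulate-cong at) (Vec.tabulate∘lookup S))
    where
    at : ∀ i → lookup (terminalCut S) (term i) ≡ lookup S i
    at i rewrite Vec.lookup∘tabulate (λ v → does (inS? S v)) (term i)
      with lookup S i in eq
    ... | true  = dec-true (inS? S (term i)) (i , Vec.lookup⇒[]= i S eq , refl)
    ... | false = dec-false (inS? S (term i)) λ (j , j∈S , e) →
      contradiction
        (trans (sym (Vec.[]=⇒lookup j∈S)) (trans (cong (lookup S) (term-inj e)) eq))
        λ ()

allSubsets : ∀ n → List (Subset n)
allSubsets zero    = [] ∷ []
allSubsets (suc n) =
  map (outside ∷_) (allSubsets n) ++ map (inside ∷_) (allSubsets n)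

module _ {k : ℕ} (N : Network k) where
  open Network N

  -- The minimum of cutCost over all S-separating cuts.  The fold starts
  -- from one such cut, so that the minimum is over a nonempty list.
  mincut : Subset k → ℝ
  mincut S = foldr _⊓ᴿ_ (cutCost (terminalCut S))
    (map cutCost (filter (separates? S) (allSubsets ∣V∣)))

  -- Every edge joins a terminal to a non-terminal.
  BipartiteByTerminals : Set
  BipartiteByTerminals = ∀ e →
      (IsTerminal (src e) × ¬ IsTerminal (tgt e))
    ⊎ (¬ IsTerminal (src e) × IsTerminal (tgt e))

-- IsMimicking N′ N: N′ is a mimicking network of N.
IsMimicking : ∀ {k} → Network k → Network k → Set
IsMimicking N′ N = ∀ S → Nonempty S → Nonempty (∁ S) → mincut N′ S ≃ mincut N S

{-# OPTIONS --safe #-}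
module Submission where

-- Let R = 2^n with n about k/2.  We choose R terminal sets S_x and a network N
-- in which mincut(S_x) = Λ(S_x) - s 2^x, where Λ is additive over terminals and
-- s > 2R.  Suppose that N′ with m edges mimics N.  Evaluate all costs of N′ at a
-- late index of their Cauchy sequences, and pick minimum cuts there.  Then
-- Λ(S_x) - mincut′(S_x) is a 0/1-combination of k + m fixed rationals (one per
-- terminal, one per edge of N′) that is within 1 of s 2^x.  If (R + 1)^(k + m) < 2^R,
-- the pigeonhole principle gives two distinct sets of indices x using each of these
-- rationals equally often, so their sums of s 2^x differ by at most 2R < s, which
-- contradicts uniqueness of binary expansions.  Hence 2^R ≤ (R + 1)^(k + m), that is,
-- 2^n is at most (n + 1)(k + m), a polynomial in |V(N′)|.

open import Defs
open import Data.Nat.Base using (ℕ; _>_)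
open import Data.Product.Base using (Σ-syntax; _×_)

open import Algebra.Bundles using (CommutativeMonoid)
import Algebra.Properties.CommutativeMonoid.Sum as Sum
import Algebra.Properties.Monoid.Mult as Mult
import Algebra.Properties.Semiring.Sum as SemiringSum
open import Data.Bool.Base using (Bool; true; false; if_then_else_; not; _∧_; _xor_)
import Data.Bool.Properties as Bool
open import Data.Empty using (⊥)
open import Data.Fin.Base as Fin
  using (Fin; zero; suc; toℕ; fromℕ<; _↑ˡ_; _↑ʳ_; combine; quotient; remainder; finToFun; funToFin)
import Data.Fin.Properties as Fin
open import Data.Fin.Subset using (Subset; Nonempty; ∁)
open import Data.Integer.Base as ℤ using (+_; -[1+_])
import Data.Integer.Properties as ℤ
open import Data.List.Base using (List; []; _∷_; map; foldr; filter)
open import Data.List.Membership.Propositional using (_∈_)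
open import Data.List.Membership.Propositional.Properties
  using (∈-++⁺ˡ; ∈-++⁺ʳ; ∈-map⁺; ∈-filter⁺; ∈-filter⁻)
open import Data.List.Relation.Unary.Any using (here; there)
open import Data.Nat.Base as ℕ using (zero; suc; z≤n; s≤s)
import Data.Nat.Properties as ℕ
open import Data.Nat.Solver using () renaming (module +-*-Solver to ℕ-Solver)
open import Data.Product.Base using (_,_; proj₁; proj₂; ∃₂; ∃-syntax)
open import Data.Rational.Base as ℚ using (ℚ; mkℚ; 0ℚ; 1ℚ)
import Data.Rational.Properties as ℚ
open import Data.Rational.Solver using () renaming (module +-*-Solver to ℚ-Solver)
import Data.Rational.Unnormalised.Base as ℚᵘ
import Data.Rational.Unnormalised.Properties as ℚᵘ
open import Data.Sum.Base using (_⊎_; inj₁; inj₂; [_,_]′)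
import Data.Vec.Base as Vec
open import Data.Vec.Functional using (Vector; _++_)
import Data.Vec.Functional.Properties as Vector
import Data.Vec.Properties as Vec
open import Function.Base using (_∘_)
open import Relation.Binary.PropositionalEquality as ≡
  using (_≡_; _≢_; refl; sym; trans; cong; cong₂; subst; subst₂)
open import Relation.Nullary using (does; yes; no; contradiction)

-- Finite sums

count : ∀ {n} → (Fin n → Bool) → ℕ
count = Sum.sum ℕ.+-0-commutativeMonoid ∘ λ p i → if p i then 1 else 0

module Sums {a ℓ} (M : CommutativeMonoid a ℓ) where
  open CommutativeMonoid M
    renaming (_∙_ to _+_; ε to 0#; ∙-cong to +-cong; ∙-congˡ to +-congˡ; refl to ≈-refl; sym to ≈-sym; trans to ≈-trans)
  open Sum M public
  open Mult monoid using () renaming (_×_ to _·_)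
  open import Relation.Binary.Reasoning.Setoid setoid

  sum-↑ : ∀ m {n} (f : Fin (m ℕ.+ n) → Carrier) →
    sum f ≈ sum (f ∘ (_↑ˡ n)) + sum (f ∘ (m ↑ʳ_))
  sum-↑ zero    f = ≈-sym (identityˡ _)
  sum-↑ (suc m) f = ≈-trans
    (+-congˡ (sum-↑ m (f ∘ suc))) (≈-sym (assoc _ _ _))

  sum-++ : ∀ {b c} {B : Set b} {C : Set c} (f : B → C → Carrier) {m n}
    (xs : Vector B m) (ys : Vector B n) (us : Vector C m) (vs : Vector C n) →
    sum (λ i → f ((xs ++ ys) i) ((us ++ vs) i)) ≈
    sum (λ i → f (xs i) (us i)) + sum (λ i → f (ys i) (vs i))
  sum-++ f {m} {n} xs ys us vs = ≈-trans (sum-↑ m λ i → f ((xs ++ ys) i) ((us ++ vs) i))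
    (reflexive (≡.cong₂ _+_
      (sum-cong-≗ λ i → cong₂ f (Vector.lookup-++ˡ xs ys i) (Vector.lookup-++ˡ us vs i))
      (sum-cong-≗ λ i → cong₂ f (Vector.lookup-++ʳ xs ys i) (Vector.lookup-++ʳ us vs i))))

  sum-combine : ∀ m {n} (f : Fin (m ℕ.* n) → Carrier) →
    sum f ≈ sum λ i → sum λ j → f (combine {m} i j)
  sum-combine zero    f = ≈-refl
  sum-combine (suc m) {n} f = ≈-trans
    (sum-↑ n f) (+-congˡ (sum-combine m (f ∘ (n ↑ʳ_))))

  if-sum : ∀ {n} b (f : Fin n → Carrier) →
    (if b then sum f else 0#) ≈ sum λ i → if b then f i else 0#
  if-sum true  f = ≈-refl
  if-sum {n} false f = ≈-sym (sum-replicate-zero n)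

  sum-if : ∀ {n} (p : Fin n → Bool) x →
    (sum λ i → if p i then x else 0#) ≈ count p · x
  sum-if {zero}  p x = ≈-refl
  sum-if {suc n} p x with p zero
  ... | true  = +-congˡ (sum-if (p ∘ suc) x)
  ... | false = ≈-trans (identityˡ _) (sum-if (p ∘ suc) x)

  sum-indicator : ∀ {n} (i : Fin n) (f : Fin n → Carrier) →
    (sum λ j → if does (i Fin.≟ j) then f j else 0#) ≈ f i
  sum-indicator {suc n} zero    f = ≈-trans
    (+-congˡ (sum-replicate-zero n)) (identityʳ _)
  sum-indicator {suc n} (suc i) f = ≈-trans
    (identityˡ _) (sum-indicator i (f ∘ suc))

  -- Exchanging the two summations counts how often each `c j` is used by the selected rows. Two
  -- selections with the same column counts therefore have the same sum, whatever `c` is.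
  sum-of-subsums : ∀ {m n} (χ : Fin m → Bool) (h : Fin m → Fin n → Bool) (c : Fin n → Carrier) →
    (sum λ x → if χ x then sum (λ j → if h x j then c j else 0#) else 0#) ≈
    sum λ j → count (λ x → χ x ∧ h x j) · c j
  sum-of-subsums {m} {n} χ h c = begin
    (sum λ x → if χ x then sum (λ j → if h x j then c j else 0#) else 0#)
      ≈⟨ sum-cong-≋ (λ x → if-sum (χ x) λ j → if h x j then c j else 0#) ⟩
    (sum λ x → sum λ j → nested x j)
      ≈⟨ ∑-comm nested ⟩
    (sum λ j → sum λ x → nested x j)
      ≡⟨ sum-cong-≗ {n} (λ j → sum-cong-≗ λ x → if-∧ (χ x)) ⟩
    (sum λ j → sum λ x → if χ x ∧ h x j then c j else 0#)
      ≈⟨ sum-cong-≋ (λ j → sum-if (λ x → χ x ∧ h x j) (c j)) ⟩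
    (sum λ j → count (λ x → χ x ∧ h x j) · c j) ∎
    where
    nested : Fin m → Fin n → Carrier
    nested x j = if χ x then (if h x j then c j else 0#) else 0#
    if-∧ : ∀ b {c} {x : Carrier} →
      (if b then (if c then x else 0#) else 0#) ≡ (if b ∧ c then x else 0#)
    if-∧ true  = refl
    if-∧ false = refl

module ∑ℕ = Sums ℕ.+-0-commutativeMonoid
module ∑ℚ = Sums ℚ.+-0-commutativeMonoid

sumℕ-mono-≤ : ∀ {n} {f g : Fin n → ℕ} → (∀ i → f i ℕ.≤ g i) → ∑ℕ.sum f ℕ.≤ ∑ℕ.sum g
sumℕ-mono-≤ {zero}  f≤g = z≤n
sumℕ-mono-≤ {suc n} f≤g = ℕ.+-mono-≤ (f≤g zero) (sumℕ-mono-≤ (f≤g ∘ suc))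

sumℕ-mono-< : ∀ {n} {f g : Fin n → ℕ} → (∀ i → f i ℕ.≤ g i) →
  ∀ i → f i ℕ.< g i → ∑ℕ.sum f ℕ.< ∑ℕ.sum g
sumℕ-mono-< f≤g zero    f<g = ℕ.+-mono-<-≤ f<g (sumℕ-mono-≤ (f≤g ∘ suc))
sumℕ-mono-< f≤g (suc i) f<g = ℕ.+-mono-≤-< (f≤g zero) (sumℕ-mono-< (f≤g ∘ suc) i f<g)

sumℚ-mono-≤ : ∀ {n} {f g : Fin n → ℚ} → (∀ i → f i ℚ.≤ g i) → ∑ℚ.sum f ℚ.≤ ∑ℚ.sum g
sumℚ-mono-≤ {zero}  f≤g = ℚ.≤-refl
sumℚ-mono-≤ {suc n} f≤g = ℚ.+-mono-≤ (f≤g zero) (sumℚ-mono-≤ (f≤g ∘ suc))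

sumℕ-const : ∀ n c → ∑ℕ.sum {n} (λ _ → c) ≡ n ℕ.* c
sumℕ-const zero    c = refl
sumℕ-const (suc n) c = cong (c ℕ.+_) (sumℕ-const n c)

count≤n : ∀ {n} (p : Fin n → Bool) → count p ℕ.≤ n
count≤n {n} p = ℕ.≤-trans (sumℕ-mono-≤ (λ i → if-≤1 (p i)))
  (ℕ.≤-reflexive (trans (sumℕ-const n 1) (ℕ.*-identityʳ n)))
  where
  if-≤1 : ∀ b → (if b then 1 else 0) ℕ.≤ 1
  if-≤1 true  = s≤s z≤n
  if-≤1 false = z≤n

-- Natural numbers as rationals.

module ·ℚ = Mult ℚ.+-0-monoid

-- Encoded as a multiple of `1ℚ`, so that additivity is `×-homo-+` and a sum of R ones is literally
-- `ι R`.
ι : ℕ → ℚ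
ι n = n ·ℚ.× 1ℚ

ι-homo-+ : ∀ m n → ι (m ℕ.+ n) ≡ ι m ℚ.+ ι n
ι-homo-+ = ·ℚ.×-homo-+ 1ℚ

ι-homo-sum : ∀ {n} (f : Fin n → ℕ) → ι (∑ℕ.sum f) ≡ ∑ℚ.sum (ι ∘ f)
ι-homo-sum {zero}  f = refl
ι-homo-sum {suc n} f =
  trans (ι-homo-+ (f zero) _) (cong (ι (f zero) ℚ.+_) (ι-homo-sum (f ∘ suc)))

ι-if : ∀ b n → ι (if b then n else 0) ≡ (if b then ι n else 0ℚ)
ι-if true  n = refl
ι-if false n = refl

ι-mono-≤ : ∀ {m n} → m ℕ.≤ n → ι m ℚ.≤ ι n
ι-mono-≤ {n = zero}  z≤n     = ℚ.≤-refl
ι-mono-≤ {n = suc n} z≤n     = ℚ.+-mono-≤ (ℚ.nonNegative⁻¹ 1ℚ) (ι-mono-≤ {n = n} z≤n)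
ι-mono-≤             (s≤s h) = ℚ.+-monoʳ-≤ 1ℚ (ι-mono-≤ h)

ι-<-suc : ∀ n → ι n ℚ.< ι (suc n)
ι-<-suc n = subst (ℚ._< ι (suc n)) (ℚ.+-identityˡ (ι n)) (ℚ.+-monoˡ-< (ι n) (ℚ.positive⁻¹ 1ℚ))

ι-pos : ∀ {n} → 0 ℕ.< n → 0ℚ ℚ.< ι n
ι-pos {suc n} _ = ℚ.≤-<-trans (ι-mono-≤ {n = n} z≤n) (ι-<-suc n)

ι-cancel-≤ : ∀ {m n} → ι m ℚ.≤ ι n → m ℕ.≤ n
ι-cancel-≤ {m} {n} h = ℕ.≮⇒≥ λ n<m →
  ℚ.<-irrefl refl (ℚ.<-≤-trans (ι-<-suc n) (ℚ.≤-trans (ι-mono-≤ n<m) h))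

-- Binary digits, most significant first.

isOne : Fin 2 → Bool
isOne zero    = false
isOne (suc _) = true

digit : ∀ n → Fin (2 ℕ.^ n) → Fin n → Bool
digit n F i = isOne (finToFun {2} {n} F i)

place : ∀ {n} → Fin n → ℕ
place {suc n} zero    = 2 ℕ.^ n
place {suc n} (suc i) = place i

place-pos : ∀ {n} (i : Fin n) → 0 ℕ.< place i
place-pos {suc n} zero    = ℕ.m^n>0 2 n
place-pos {suc n} (suc i) = place-pos i

placeValue : ∀ n → Fin (2 ℕ.^ n) → Fin n → ℕ
placeValue n F i = if digit n F i then place i else 0

-- By induction: `finToFun` splits F into its leading digit q and the remainder r, and `combine`
-- reassembles them as 2^n q + r.
sum-digits : ∀ n (F : Fin (2 ℕ.^ n)) → ∑ℕ.sum (placeValue n F) ≡ toℕ F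
sum-digits zero    zero = refl
sum-digits (suc n) F = begin
  (if isOne q then 2 ℕ.^ n else 0) ℕ.+ ∑ℕ.sum (placeValue n r)
    ≡⟨ cong₂ ℕ._+_ (leading q) (sum-digits n r) ⟩
  2 ℕ.^ n ℕ.* toℕ q ℕ.+ toℕ r
    ≡⟨ Fin.toℕ-combine q r ⟨
  toℕ (combine q r)
    ≡⟨ cong toℕ (Fin.combine-remQuot {2} (2 ℕ.^ n) F) ⟩
  toℕ F ∎
  where
  open ≡.≡-Reasoning
  q = quotient {2} (2 ℕ.^ n) F
  r = remainder {2} (2 ℕ.^ n) F
  leading : ∀ d → (if isOne d then 2 ℕ.^ n else 0) ≡ 2 ℕ.^ n ℕ.* toℕ d
  leading zero       = sym (ℕ.*-zeroʳ (2 ℕ.^ n))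
  leading (suc zero) = sym (ℕ.*-identityʳ (2 ℕ.^ n))

digit-injective : ∀ n {F G} → (∀ i → digit n F i ≡ digit n G i) → F ≡ G
digit-injective n {F} {G} h = Fin.toℕ-injective (begin
  toℕ F                        ≡⟨ sum-digits n F ⟨
  ∑ℕ.sum (placeValue n F)      ≡⟨ ∑ℕ.sum-cong-≗ (λ i → cong (λ b → if b then place i else 0) (h i)) ⟩
  ∑ℕ.sum (placeValue n G)      ≡⟨ sum-digits n G ⟩
  toℕ G                        ∎)
  where open ≡.≡-Reasoning

-- The numbers F and G stand for their sets of binary digits, that is, sets of rows of h.
EqualColumnCounts : ∀ {R m} → (Fin R → Fin m → Bool) → Set
EqualColumnCounts {R} h = ∃₂ λ (F G : Fin (2 ℕ.^ R)) → toℕ F ℕ.< toℕ G ×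
  ∀ j → count (λ x → digit R F x ∧ h x j) ≡ count (λ x → digit R G x ∧ h x j)

-- Each of the m counts lies in 0, ..., R, so a set of rows has at most (R + 1)^m possible count
-- vectors, fewer than the 2^R sets of rows. The library's pigeonhole already orders the colliding
-- pair.
equal-column-counts : ∀ {R m} (h : Fin R → Fin m → Bool) →
  suc R ℕ.^ m ℕ.< 2 ℕ.^ R → EqualColumnCounts h
equal-column-counts {R} {m} h few = conclude (Fin.pigeonhole few (funToFin ∘ counts))
  where
  counts : Fin (2 ℕ.^ R) → Fin m → Fin (suc R)
  counts F j = fromℕ< (s≤s (count≤n λ x → digit R F x ∧ h x j))
  decode : ∀ F j → toℕ (finToFun (funToFin (counts F)) j) ≡ count (λ x → digit R F x ∧ h x j)
  decode F j = trans (cong toℕ (Fin.finToFun-funToFin (counts F) j)) (Fin.toℕ-fromℕ< _)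
  conclude : (∃₂ λ F G → toℕ F ℕ.< toℕ G × funToFin (counts F) ≡ funToFin (counts G)) → EqualColumnCounts h
  conclude (F , G , F<G , eq) = F , G , F<G , λ j →
    trans (sym (decode F j)) (trans (cong (λ c → toℕ (finToFun {suc R} {m} c j)) eq) (decode G j))

-- Rationals with subset sums close to widely spaced powers of 2.

scale : ℕ → ℕ
-- Two sums of at most R terms, each term off by at most 1, differ from their ideal values by at
-- most 2R in total; the spacing has to exceed this.
scale R = suc (R ℕ.+ R)

module _ {R m : ℕ} (h : Fin R → Fin m → Bool) (c : Fin m → ℚ) where

  rowSum : Fin R → ℚ
  rowSum x = ∑ℚ.sum λ j → if h x j then c j else 0ℚ

  private
    -- Rows double as digit positions: `place x` is 2^(R-1-x), so the total weight of the set coded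
    -- by F is `scale R` times F.
    weight : Fin R → ℕ
    weight x = scale R ℕ.* place x

    combination : Fin (2 ℕ.^ R) → ℚ
    combination F = ∑ℚ.sum λ x → if digit R F x then rowSum x else 0ℚ

    -- Unselected rows are granted the slack 1 as well, which makes the total error R for every F.
    if-mono-≤ : ∀ b {p q} → p ℚ.≤ q ℚ.+ 1ℚ →
      (if b then p else 0ℚ) ℚ.≤ (if b then q else 0ℚ) ℚ.+ 1ℚ
    if-mono-≤ true  h = h
    if-mono-≤ false h = ℚ.nonNegative⁻¹ 1ℚ

    sum-+1 : (f : Fin R → ℚ) → (∑ℚ.sum λ x → f x ℚ.+ 1ℚ) ≡ ∑ℚ.sum f ℚ.+ ι R
    sum-+1 f = trans (∑ℚ.∑-distrib-+ f (λ _ → 1ℚ)) (cong (∑ℚ.sum f ℚ.+_) (∑ℚ.sum-replicate R))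

    weight-combination : ∀ F → (∑ℚ.sum λ x → if digit R F x then ι (weight x) else 0ℚ) ≡ ι (scale R ℕ.* toℕ F)
    weight-combination F = begin
      (∑ℚ.sum λ x → if digit R F x then ι (weight x) else 0ℚ)
        ≡⟨ ∑ℚ.sum-cong-≗ (λ x → sym (ι-if (digit R F x) (weight x))) ⟩
      (∑ℚ.sum λ x → ι (if digit R F x then weight x else 0))
        ≡⟨ ι-homo-sum {R} (λ x → if digit R F x then weight x else 0) ⟨
      ι (∑ℕ.sum λ x → if digit R F x then weight x else 0)
        ≡⟨ cong ι (∑ℕ.sum-cong-≗ {R} λ x → if-* (digit R F x)) ⟩
      ι (∑ℕ.sum λ x → scale R ℕ.* placeValue R F x)
        ≡⟨ cong ι (SemiringSum.*-distribˡ-sum ℕ.+-*-semiring (scale R) (placeValue R F)) ⟨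
      ι (scale R ℕ.* ∑ℕ.sum (placeValue R F))
        ≡⟨ cong (λ z → ι (scale R ℕ.* z)) (sum-digits R F) ⟩
      ι (scale R ℕ.* toℕ F) ∎
      where
      open ≡.≡-Reasoning
      if-* : ∀ b {n} → (if b then scale R ℕ.* n else 0) ≡ scale R ℕ.* (if b then n else 0)
      if-* true  = refl
      if-* false = sym (ℕ.*-zeroʳ (scale R))

  module _ (upper : ∀ x → rowSum x ℚ.≤ ι (weight x) ℚ.+ 1ℚ)
           (lower : ∀ x → ι (weight x) ℚ.≤ rowSum x ℚ.+ 1ℚ) where

    private
      combination-upper : ∀ F → combination F ℚ.≤ ι (scale R ℕ.* toℕ F) ℚ.+ ι R
      combination-upper F = ℚ.≤-trans
        (sumℚ-mono-≤ λ x → if-mono-≤ (digit R F x) (upper x))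
        (ℚ.≤-reflexive (trans (sum-+1 _) (cong (ℚ._+ ι R) (weight-combination F))))

      combination-lower : ∀ F → ι (scale R ℕ.* toℕ F) ℚ.≤ combination F ℚ.+ ι R
      combination-lower F = ℚ.≤-trans
        (ℚ.≤-reflexive (sym (weight-combination F)))
        (ℚ.≤-trans
          (sumℚ-mono-≤ λ x → if-mono-≤ (digit R F x) (lower x))
          (ℚ.≤-reflexive (sum-+1 _)))

    subsums-near-powers : 2 ℕ.^ R ℕ.≤ suc R ℕ.^ m
    subsums-near-powers = ℕ.≮⇒≥ λ few → impossible (equal-column-counts h few)
      where
      impossible : EqualColumnCounts h → ⊥
      impossible (F , G , F<G , eq) = ℕ.<⇒≱ gap (ι-cancel-≤ close)
        where
        open ℚ.≤-Reasoning
        equal : combination F ≡ combination G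
        equal = trans (∑ℚ.sum-of-subsums (digit R F) h c) (trans
          (∑ℚ.sum-cong-≗ λ j → cong (·ℚ._× c j) (eq j))
          (sym (∑ℚ.sum-of-subsums (digit R G) h c)))
        close : ι (scale R ℕ.* toℕ G) ℚ.≤ ι (scale R ℕ.* toℕ F ℕ.+ R ℕ.+ R)
        close = begin
          ι (scale R ℕ.* toℕ G)                      ≤⟨ combination-lower G ⟩
          combination G ℚ.+ ι R                      ≡⟨ cong (ℚ._+ ι R) equal ⟨
          combination F ℚ.+ ι R                      ≤⟨ ℚ.+-monoˡ-≤ (ι R) (combination-upper F) ⟩
          ι (scale R ℕ.* toℕ F) ℚ.+ ι R ℚ.+ ι R      ≡⟨ cong (ℚ._+ ι R) (ι-homo-+ (scale R ℕ.* toℕ F) R) ⟨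
          ι (scale R ℕ.* toℕ F ℕ.+ R) ℚ.+ ι R        ≡⟨ ι-homo-+ (scale R ℕ.* toℕ F ℕ.+ R) R ⟨
          ι (scale R ℕ.* toℕ F ℕ.+ R ℕ.+ R)          ∎
        -- Already F + 1 in place of F gains `scale R` = 2R + 1, one more than the two errors
        -- together.
        gap : scale R ℕ.* toℕ F ℕ.+ R ℕ.+ R ℕ.< scale R ℕ.* toℕ G
        gap = ℕ.≤-trans
          (ℕ.≤-reflexive (solve 2 (λ a r → con 1 :+ (a :+ r :+ r) := con 1 :+ (r :+ r) :+ a) refl (scale R ℕ.* toℕ F) R))
          (ℕ.≤-trans (ℕ.≤-reflexive (sym (ℕ.*-suc (scale R) (toℕ F)))) (ℕ.*-monoʳ-≤ (scale R) F<G))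
          where open ℕ-Solver

-- Minimum cuts and powers of 2

seq-∑ : ∀ {n} (f : Fin n → ℝ) t → seq (∑ f) t ≡ ∑ℚ.sum (λ i → seq (f i) t)
seq-∑ {zero}  f t = refl
seq-∑ {suc n} f t = cong (seq (f zero) t ℚ.+_) (seq-∑ (f ∘ suc) t)

seq-if : ∀ b (x : ℝ) t → seq (if b then x else 0ᴿ) t ≡ (if b then seq x t else 0ℚ)
seq-if true  x t = refl
seq-if false x t = refl

∈-allSubsets : ∀ {n} (W : Subset n) → W ∈ allSubsets n
∈-allSubsets Vec.[]            = here refl
∈-allSubsets (false Vec.∷ W) = ∈-++⁺ˡ (∈-map⁺ (false Vec.∷_) (∈-allSubsets W))
∈-allSubsets {suc n} (true Vec.∷ W) =
  ∈-++⁺ʳ (map (false Vec.∷_) (allSubsets n)) (∈-map⁺ (true Vec.∷_) (∈-allSubsets W))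

eventually-all : ∀ {n} {P : Fin n → ℕ → Set} →
  (∀ i → Eventually (P i)) → Eventually λ t → ∀ i → P i t
eventually-all {zero}  h = 0 , λ _ _ ()
eventually-all {suc n} {P} h with h zero | eventually-all (h ∘ suc)
... | M , p | L , q = M ℕ.⊔ L , λ t t≥ → λ where
  zero    → p t (ℕ.m⊔n≤o⇒m≤o M L t≥)
  (suc i) → q t (ℕ.m⊔n≤o⇒n≤o M L t≥) i

module _ {A : Set} (c : A → ℝ) (z : A) (t : ℕ) where

  private
    minimum : List A → ℚ
    minimum xs = seq (foldr _⊓ᴿ_ (c z) (map c xs)) t

  minimum-≤ : ∀ {xs x} → x ∈ xs → minimum xs ℚ.≤ seq (c x) t
  minimum-≤ (here refl) = ℚ.p⊓q≤p _ _
  minimum-≤ {y ∷ _} (there x∈) = ℚ.≤-trans (ℚ.p⊓q≤q (seq (c y) t) _) (minimum-≤ x∈)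

  -- At a fixed index `_⊓ᴿ_` is a minimum of two rationals and equals one of them. The attaining
  -- element may change with the index, and it may be the initial value z of the fold.
  minimum-attained : ∀ xs → ∃[ x ] x ∈ z ∷ xs × minimum xs ≡ seq (c x) t
  minimum-attained []       = z , here refl , refl
  minimum-attained (y ∷ xs) = [ here-y , in-tail (minimum-attained xs) ]′ (ℚ.⊓-sel (seq (c y) t) (minimum xs))
    where
    here-y : minimum (y ∷ xs) ≡ seq (c y) t → _
    here-y e = y , there (here refl) , e
    in-tail : (∃[ x ] x ∈ z ∷ xs × minimum xs ≡ seq (c x) t) →
      minimum (y ∷ xs) ≡ minimum xs → ∃[ x ] x ∈ z ∷ y ∷ xs × minimum (y ∷ xs) ≡ seq (c x) t
    in-tail (x , here x≡z , e′) e = x , here x≡z , trans e e′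
    in-tail (x , there x∈ , e′) e = x , there (there x∈) , trans e e′

module _ {k} (N : Network k) where
  open Network N

  seq-cutCost : ∀ W t →
    seq (cutCost W) t ≡ ∑ℚ.sum λ e → if Crosses W e then seq (cost e) t else 0ℚ
  seq-cutCost W t = trans (seq-∑ (λ e → if Crosses W e then cost e else 0ᴿ) t)
    (∑ℚ.sum-cong-≗ λ e → seq-if (Crosses W e) (cost e) t)

  mincut-≤ : ∀ {S W} t → Separates S W → seq (mincut N S) t ℚ.≤ seq (cutCost W) t
  mincut-≤ {S} {W} t sep = minimum-≤ cutCost (terminalCut S) t
    (∈-filter⁺ (separates? S) (∈-allSubsets W) sep)

  mincut-attained : ∀ S t → ∃[ W ] Separates S W × seq (mincut N S) t ≡ seq (cutCost W) t
  mincut-attained S t =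
    let W , W∈ , e = minimum-attained cutCost (terminalCut S) t candidates in W , separates W∈ , e
    where
    candidates = filter (separates? S) (allSubsets ∣V∣)
    separates : ∀ {W} → W ∈ terminalCut S ∷ candidates → Separates S W
    separates (here refl) = terminalCut-separates S
    separates (there W∈)  = proj₂ (∈-filter⁻ (separates? S) {xs = allSubsets ∣V∣} W∈)

  -- In a simple graph the ordered pair of stored endpoints determines the edge.
  ∣E∣≤∣V∣² : ∣E∣ ℕ.≤ ∣V∣ ℕ.* ∣V∣
  ∣E∣≤∣V∣² = Fin.injective⇒≤ {f = λ e → combine (src e) (tgt e)} λ {e} {f} eq →
    let s , t = Fin.combine-injective (src e) (tgt e) (src f) (tgt f) eq in simple s t

  k≤∣V∣ : k ℕ.≤ ∣V∣
  k≤∣V∣ = Fin.injective⇒≤ term-inj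

-- Rational inequalities and real exponents of 2.

∣-∣<⇒≤ : ∀ {p q ε} → ℚ.∣ p ℚ.- q ∣ ℚ.< ε → p ℚ.≤ q ℚ.+ ε × q ℚ.≤ p ℚ.+ ε
∣-∣<⇒≤ {p} {q} {ε} h = lemma p q h ,
  lemma q p (subst (ℚ._< ε) (trans (sym (ℚ.∣-p∣≡∣p∣ (p ℚ.- q)))
    (cong ℚ.∣_∣ (solve 2 (λ p q → :- (p :- q) := q :- p) refl p q))) h)
  where
  open ℚ-Solver
  p≤∣p∣ : ∀ p → p ℚ.≤ ℚ.∣ p ∣
  p≤∣p∣ p with ℚ.≤-total 0ℚ p
  ... | inj₁ 0≤p = ℚ.≤-reflexive (sym (ℚ.0≤p⇒∣p∣≡p 0≤p))
  ... | inj₂ p≤0 = ℚ.≤-trans p≤0 (ℚ.0≤∣p∣ p)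
  lemma : ∀ p q → ℚ.∣ p ℚ.- q ∣ ℚ.< ε → p ℚ.≤ q ℚ.+ ε
  lemma p q h = subst (ℚ._≤ q ℚ.+ ε)
    (solve 2 (λ p q → q :+ (p :- q) := p) refl p q)
    (ℚ.+-monoʳ-≤ q (ℚ.≤-trans (p≤∣p∣ (p ℚ.- q)) (ℚ.<⇒≤ h)))

≤+ε⇒≤ : ∀ {p q} → (∀ ε → 0ℚ ℚ.< ε → p ℚ.≤ q ℚ.+ ε) → p ℚ.≤ q
-- If q < p, take m strictly between them; the hypothesis at ε = m - q gives p ≤ m.
≤+ε⇒≤ {p} {q} h = ℚ.≮⇒≥ λ q<p → let m , q<m , m<p = ℚ.<-dense q<p in
  ℚ.<-irrefl refl (ℚ.<-≤-trans m<p (subst (p ℚ.≤_)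
    (solve 2 (λ q m → q :+ (m :- q) := m) refl q m)
    (h (m ℚ.- q) (subst (ℚ._< m ℚ.- q) (ℚ.+-inverseʳ q) (ℚ.+-monoˡ-< (ℚ.- q) q<m)))))
  where open ℚ-Solver

^-cancelˡ-≤ : ∀ {m n} o .{{_ : ℕ.NonZero o}} → m ℕ.^ o ℕ.≤ n ℕ.^ o → m ℕ.≤ n
^-cancelˡ-≤ o h = ℕ.≮⇒≥ λ n<m → ℕ.<⇒≱ (ℕ.^-monoˡ-< o n<m) h

module _ (d-1 : ℕ) where

  private
    d : ℕ
    d = suc d-1

  1/d : ℚ
  1/d = ℚ.fromℚᵘ (ℚᵘ.mkℚᵘ (+ 1) d-1)

  -- Stated for unnormalised rationals, where the fraction k/d need not be reduced to lowest terms.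
  k/d : ∀ k → ℚ.toℚᵘ (∑ℚ.sum {k} (λ _ → 1/d)) ℚᵘ.≃ ℚᵘ.mkℚᵘ (+ k) d-1
  k/d zero    = ℚᵘ.*≡* refl
  k/d (suc k) = ℚᵘ.≃-trans (ℚ.toℚᵘ-homo-+ 1/d (∑ℚ.sum {k} (λ _ → 1/d)))
    (ℚᵘ.≃-trans (ℚᵘ.+-cong (ℚ.toℚᵘ-fromℚᵘ (ℚᵘ.mkℚᵘ (+ 1) d-1)) (k/d k)) (ℚᵘ.*≡* (begin
      (+ 1 ℤ.* + d ℤ.+ + k ℤ.* + d) ℤ.* + d  ≡⟨ cong (ℤ._* + d) (ℤ.*-distribʳ-+ (+ d) (+ 1) (+ k)) ⟨
      + suc k ℤ.* + d ℤ.* + d                ≡⟨ ℤ.*-assoc (+ suc k) (+ d) (+ d) ⟩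
      + suc k ℤ.* (+ d ℤ.* + d)              ≡⟨ cong (+ suc k ℤ.*_) (ℤ.pos-* d d) ⟨
      + suc k ℤ.* + (d ℕ.* d)                ∎)))
    where open ≡.≡-Reasoning

  -- If p/q ≤ k/d, then pd ≤ kq, so (2^p)^d ≤ (2^k)^q ≤ (v^q)^d, and d-th roots can be taken.
  2^[k/d]≤ : ∀ k v .{{_ : ℕ.NonZero v}} → 2 ℕ.^ k ℕ.≤ v ℕ.^ d → PowTwo≤ (k ·ᴿ fromℚ 1/d) v
  2^[k/d]≤ k v 2^k≤v^d r@(mkℚ (+ p) q-1 _) r≤ = ^-cancelˡ-≤ d (begin
    (2 ℕ.^ p) ℕ.^ d              ≡⟨ ℕ.^-*-assoc 2 p d ⟩
    2 ℕ.^ (p ℕ.* d)              ≤⟨ ℕ.^-monoʳ-≤ 2 p*d≤k*q ⟩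
    2 ℕ.^ (k ℕ.* suc q-1)        ≡⟨ ℕ.^-*-assoc 2 k (suc q-1) ⟨
    (2 ℕ.^ k) ℕ.^ suc q-1        ≤⟨ ℕ.^-monoˡ-≤ (suc q-1) 2^k≤v^d ⟩
    (v ℕ.^ d) ℕ.^ suc q-1        ≡⟨ ℕ.^-*-assoc v d (suc q-1) ⟩
    v ℕ.^ (d ℕ.* suc q-1)        ≡⟨ cong (v ℕ.^_) (ℕ.*-comm d (suc q-1)) ⟩
    v ℕ.^ (suc q-1 ℕ.* d)        ≡⟨ ℕ.^-*-assoc v (suc q-1) d ⟨
    (v ℕ.^ suc q-1) ℕ.^ d        ∎)
    where
    open ℕ.≤-Reasoning
    r≤k/d : r ℚ.≤ ∑ℚ.sum {k} (λ _ → 1/d)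
    r≤k/d = ≤+ε⇒≤ λ ε 0<ε → let t , h = r≤ ε 0<ε in
      subst (λ s → r ℚ.≤ s ℚ.+ ε) (seq-∑ {k} (λ _ → fromℚ 1/d) t) (h t ℕ.≤-refl)
    p*d≤k*q : p ℕ.* d ℕ.≤ k ℕ.* suc q-1
    p*d≤k*q = ℤ.drop‿+≤+ (subst₂ ℤ._≤_ (sym (ℤ.pos-* p d)) (sym (ℤ.pos-* k (suc q-1)))
      (ℚᵘ.drop-*≤* (ℚᵘ.≤-respʳ-≃ (k/d k) (ℚ.toℚᵘ-mono-≤ r≤k/d))))
  -- For a negative exponent the claim is only that a product of positive numbers is at least 1.
  2^[k/d]≤ k v _ (mkℚ -[1+ p-1 ] q-1 _) _ =
    ℕ.*-mono-≤ (ℕ.m^n>0 2 (suc p-1)) (ℕ.m^n>0 v (suc q-1))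

-- The network

not-xor : ∀ a b → not a xor b ≡ a xor not b
not-xor false b = refl
not-xor true  b = sym (Bool.not-involutive b)

sum-if-neg : ∀ {n} (p : Fin n → Bool) (c : Fin n → ℚ) →
  (∑ℚ.sum λ i → if p i then ℚ.- c i else 0ℚ) ≡ ℚ.- (∑ℚ.sum λ i → if p i then c i else 0ℚ)
sum-if-neg {zero}  p c = refl
sum-if-neg {suc n} p c = trans
  (cong₂ ℚ._+_ (if-neg (p zero)) (sum-if-neg (p ∘ suc) (c ∘ suc)))
  (sym (ℚ.neg-distrib-+ (if p zero then c zero else 0ℚ) _))
  where
  if-neg : ∀ b {q} → (if b then ℚ.- q else 0ℚ) ≡ ℚ.- (if b then q else 0ℚ)
  if-neg true  = refl
  if-neg false = refl

-- The complete bipartite graph between the terminals and the centers y : Fin R.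
-- Terminals i and n + i encode digit i and its negation, so the sets S x all have
-- n elements; the t tail terminals lie in no S x.  At the center y, the side of
-- S x is the cheaper one by an amount that grows with the number of digits in
-- which x and y differ, and tail-sum makes the other side cheaper by exactly 1
-- when x = y.
module Construction (n t : ℕ) (tail : Fin t → ℕ) (tail-pos : ∀ j → 0 ℕ.< tail j)
                    (tail-sum : suc (∑ℕ.sum tail) ≡ n ℕ.* 2) where

  k R : ℕ
  k = n ℕ.+ (n ℕ.+ t)
  R = 2 ℕ.^ n

  none : Fin t → Bool
  none _ = false

  inS : Fin R → Fin k → Bool
  inS x = digit n x ++ (not ∘ digit n x ++ none)

  S : Fin R → Subset k
  S x = Vec.tabulate (inS x)

  -- A terminal matching a digit of the center gets 3 and its opposite gets 1, so the terminals i
  -- and n + i together always contribute 4.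
  wt : Bool → ℕ
  wt b = if b then 3 else 1

  wt-pos : ∀ b → 0 ℕ.< wt b
  wt-pos true  = s≤s z≤n
  wt-pos false = s≤s z≤n

  affinity : Fin R → Fin k → ℕ
  affinity y = wt ∘ digit n y ++ (wt ∘ not ∘ digit n y ++ tail)

  affinity-pos : ∀ y q → 0 ℕ.< affinity y q
  affinity-pos y q with Fin.splitAt n q
  ... | inj₁ i = wt-pos _
  ... | inj₂ q′ with Fin.splitAt n q′
  ...   | inj₁ i = wt-pos _
  ...   | inj₂ j = tail-pos j

  -- The crossing cost at the center y, per unit of weight y, of a cut containing
  -- the terminals s, and containing y iff b is true.
  star : (Fin k → Bool) → Bool → Fin R → ℕ
  star s b y = ∑ℕ.sum λ q → if s q xor b then affinity y q else 0

  private
    -- The joint contribution of the terminals i and n + i to `star`, where x and y stand for the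
    -- i-th digits of the set and of the center.
    pair : Bool → Bool → Bool → ℕ
    pair b x y = (if x xor b then wt y else 0) ℕ.+ (if not x xor b then wt (not y) else 0)

    star-split : ∀ x b y → star (inS x) b y ≡
      (∑ℕ.sum λ i → pair b (digit n x i) (digit n y i)) ℕ.+ (∑ℕ.sum λ j → if b then tail j else 0)
    star-split x b y = begin
      star (inS x) b y
        ≡⟨ ∑ℕ.sum-++ summand (digit n x) _ (wt ∘ digit n y) _ ⟩
      first ℕ.+ _
        ≡⟨ cong (first ℕ.+_) (∑ℕ.sum-++ summand (not ∘ digit n x) none (wt ∘ not ∘ digit n y) tail) ⟩
      first ℕ.+ (second ℕ.+ third)
        ≡⟨ ℕ.+-assoc first second third ⟨
      first ℕ.+ second ℕ.+ third
        ≡⟨ cong (ℕ._+ third) (∑ℕ.∑-distrib-+ {n} _ _) ⟨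
      (∑ℕ.sum λ i → pair b (digit n x i) (digit n y i)) ℕ.+ third ∎
      where
      open ≡.≡-Reasoning
      summand : Bool → ℕ → ℕ
      summand s a = if s xor b then a else 0
      first second third : ℕ
      first  = ∑ℕ.sum λ i → summand (digit n x i) (wt (digit n y i))
      second = ∑ℕ.sum λ i → summand (not (digit n x i)) (wt (not (digit n y i)))
      third  = ∑ℕ.sum λ j → if b then tail j else 0

    -- This is 3n minus twice the Hamming distance between the digits of x and y.
    agreement : Fin R → Fin R → ℕ
    agreement x y = ∑ℕ.sum λ i → pair false (digit n x i) (digit n y i)

    pair≤3 : ∀ x y → pair false x y ℕ.≤ 3
    pair≤3 true  true  = ℕ.≤-refl
    pair≤3 true  false = s≤s z≤n
    pair≤3 false true  = s≤s z≤n
    pair≤3 false false = ℕ.≤-refl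

    pair-refl : ∀ x → pair false x x ≡ 3
    pair-refl true  = refl
    pair-refl false = refl

    pair-≢ : ∀ {x y} → x ≢ y → pair false x y ℕ.< 3
    pair-≢ {true}  {true}  x≢y = contradiction refl x≢y
    pair-≢ {true}  {false} x≢y = s≤s (s≤s z≤n)
    pair-≢ {false} {true}  x≢y = s≤s (s≤s z≤n)
    pair-≢ {false} {false} x≢y = contradiction refl x≢y

    pair-sum : ∀ x y → pair false x y ℕ.+ pair true x y ≡ 4
    pair-sum true  true  = refl
    pair-sum true  false = refl
    pair-sum false true  = refl
    pair-sum false false = refl

    agreement-refl : ∀ x → agreement x x ≡ n ℕ.* 3
    agreement-refl x = trans (∑ℕ.sum-cong-≗ λ i → pair-refl (digit n x i)) (sumℕ-const n 3)

    agreement-≢ : ∀ {x y} → x ≢ y → agreement x y ℕ.< n ℕ.* 3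
    agreement-≢ {x} {y} x≢y with Fin.¬∀⟶∃¬ n _ (λ i → digit n x i Bool.≟ digit n y i) (x≢y ∘ digit-injective n)
    ... | i , differ = subst (agreement x y ℕ.<_) (sumℕ-const n 3)
      (sumℕ-mono-< (λ i → pair≤3 (digit n x i) (digit n y i)) i (pair-≢ differ))

    star-false : ∀ x y → star (inS x) false y ≡ agreement x y
    star-false x y = trans (star-split x false y)
      (trans (cong (agreement x y ℕ.+_) (∑ℕ.sum-replicate-zero t)) (ℕ.+-identityʳ _))

    -- Every edge at y crosses for exactly one of the two values of b. The pairs give 4n and the
    -- tail gives 2n - 1, so the two costs add up to the odd number 6n - 1.
    star-total : ∀ x y → suc (star (inS x) false y ℕ.+ star (inS x) true y) ≡ n ℕ.* 6
    star-total x y = begin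
      suc (star (inS x) false y ℕ.+ star (inS x) true y)
        ≡⟨ cong suc (cong₂ ℕ._+_ (star-false x y) (star-split x true y)) ⟩
      suc (agreement x y ℕ.+ (disagreement ℕ.+ ∑ℕ.sum tail))
        ≡⟨ solve 3 (λ a d s → con 1 :+ (a :+ (d :+ s)) := (a :+ d) :+ (con 1 :+ s)) refl
             (agreement x y) disagreement (∑ℕ.sum tail) ⟩
      agreement x y ℕ.+ disagreement ℕ.+ suc (∑ℕ.sum tail)
        ≡⟨ cong₂ ℕ._+_ (sym (∑ℕ.∑-distrib-+ {n} _ _)) tail-sum ⟩
      (∑ℕ.sum λ i → pair false (digit n x i) (digit n y i) ℕ.+ pair true (digit n x i) (digit n y i)) ℕ.+ n ℕ.* 2
        ≡⟨ cong (ℕ._+ n ℕ.* 2) (trans (∑ℕ.sum-cong-≗ λ i → pair-sum (digit n x i) (digit n y i)) (sumℕ-const n 4)) ⟩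
      n ℕ.* 4 ℕ.+ n ℕ.* 2
        ≡⟨ ℕ.*-distribˡ-+ n 4 2 ⟨
      n ℕ.* 6 ∎
      where
      open ≡.≡-Reasoning
      open ℕ-Solver
      disagreement = ∑ℕ.sum λ i → pair true (digit n x i) (digit n y i)

    n*6 : n ℕ.* 6 ≡ n ℕ.* 3 ℕ.+ n ℕ.* 3
    n*6 = ℕ.*-distribˡ-+ n 3 3

  -- In an optimal cut only the center y = x joins the side of S x; all other centers stay on the
  -- far side.
  cheapSide : Fin R → Fin R → Bool
  cheapSide x y = does (x Fin.≟ y)

  -- Leaving all centers on the far side has a cost additive over the terminals of S x. The best
  -- choice saves one unit on that at y = x, where the two costs are 3n and 3n - 1, and nothing
  -- elsewhere.
  star-gap : ∀ x y → star (inS x) false y ≡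
    star (inS x) (cheapSide x y) y ℕ.+ (if cheapSide x y then 1 else 0)
  star-gap x y with x Fin.≟ y
  ... | no  _    = sym (ℕ.+-identityʳ _)
  ... | yes refl = sym (trans (ℕ.+-comm _ 1) (ℕ.+-cancelˡ-≡ (star (inS x) false x) _ _ (begin
    star (inS x) false x ℕ.+ suc (star (inS x) true x)    ≡⟨ ℕ.+-suc _ _ ⟩
    suc (star (inS x) false x ℕ.+ star (inS x) true x)    ≡⟨ trans (star-total x x) n*6 ⟩
    n ℕ.* 3 ℕ.+ n ℕ.* 3                                   ≡⟨ cong₂ ℕ._+_ eq eq ⟨
    star (inS x) false x ℕ.+ star (inS x) false x         ∎)))
    where
    open ≡.≡-Reasoning
    eq : star (inS x) false x ≡ n ℕ.* 3
    eq = trans (star-false x x) (agreement-refl x)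

  star-min : ∀ x y b → star (inS x) (cheapSide x y) y ℕ.≤ star (inS x) b y
  star-min x y false = ℕ.≤-trans (ℕ.m≤m+n _ _) (ℕ.≤-reflexive (sym (star-gap x y)))
  star-min x y true with x Fin.≟ y
  ... | yes _   = ℕ.≤-refl
  -- A differing digit forces f ≤ 3n - 1, so at least 3n of the total 6n - 1 is left for the other
  -- side.
  ... | no  x≢y = ℕ.<⇒≤ (ℕ.+-cancelˡ-< (star (inS x) false y) _ _ (ℕ.≤-pred (begin
    suc (suc (f ℕ.+ f))               ≡⟨ cong suc (ℕ.+-suc f f) ⟨
    suc f ℕ.+ suc f                   ≤⟨ ℕ.+-mono-≤ small small ⟩
    n ℕ.* 3 ℕ.+ n ℕ.* 3               ≡⟨ trans (sym n*6) (sym (star-total x y)) ⟩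
    suc (f ℕ.+ star (inS x) true y)   ∎)))
    where
    open ℕ.≤-Reasoning
    f = star (inS x) false y
    small : f ℕ.< n ℕ.* 3
    small = subst (ℕ._< n ℕ.* 3) (sym (star-false x y)) (agreement-≢ x≢y)

  -- The unit saved at y = x is worth `weight x`, hence the powers of 2, with distinct subset sums,
  -- and the factor that dominates the approximation errors.
  weight : Fin R → ℕ
  weight y = scale R ℕ.* place y

  weight-pos : ∀ y → 0 ℕ.< weight y
  weight-pos y = ℕ.*-mono-< {0} {scale R} (s≤s z≤n) (place-pos y)

  -- The edges of the network and the cost of its cuts.

  edgeCost : Fin k → Fin R → ℕ
  edgeCost q y = weight y ℕ.* affinity y q

  edgeCost-pos : ∀ q y → 0 ℕ.< edgeCost q y
  edgeCost-pos q y = ℕ.*-mono-< (weight-pos y) (affinity-pos y q)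

  terminalOf : Fin (k ℕ.* R) → Fin k
  terminalOf = quotient {k} R

  centerOf : Fin (k ℕ.* R) → Fin R
  centerOf = remainder {k} R

  endpoints-injective : ∀ {e f} → terminalOf e ≡ terminalOf f → centerOf e ≡ centerOf f → e ≡ f
  endpoints-injective {e} {f} p q = trans (sym (Fin.combine-remQuot {k} R e))
    (trans (cong₂ combine p q) (Fin.combine-remQuot {k} R f))

  ↑ˡ<↑ʳ : ∀ (q : Fin k) (y : Fin R) → q ↑ˡ R Fin.< k ↑ʳ y
  ↑ˡ<↑ʳ q y = begin-strict
    toℕ (q ↑ˡ R)     ≡⟨ Fin.toℕ-↑ˡ q R ⟩
    toℕ q            <⟨ Fin.toℕ<n q ⟩
    k                ≤⟨ ℕ.m≤m+n k (toℕ y) ⟩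
    k ℕ.+ toℕ y      ≡⟨ Fin.toℕ-↑ʳ k y ⟨
    toℕ (k ↑ʳ y)     ∎
    where open ℕ.≤-Reasoning

  network : Network k
  network = record
    { graph = record
      { ∣V∣     = k ℕ.+ R
      ; ∣E∣     = k ℕ.* R
      ; src     = λ e → terminalOf e ↑ˡ R
      ; tgt     = λ e → k ↑ʳ centerOf e
      ; src<tgt = λ e → ↑ˡ<↑ʳ (terminalOf e) (centerOf e)
      ; simple  = λ p q → endpoints-injective (Fin.↑ˡ-injective R _ _ p) (Fin.↑ʳ-injective k _ _ q)
      }
    ; cost     = λ e → fromℚ (ι (edgeCost (terminalOf e) (centerOf e)))
    ; cost-pos = λ e → let c = edgeCost (terminalOf e) (centerOf e) in
        ι c , ι-pos (edgeCost-pos (terminalOf e) (centerOf e)) , 0 , λ _ _ → ℚ.≤-reflexive (ℚ.+-identityˡ (ι c))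
    ; term     = _↑ˡ R
    ; term-inj = Fin.↑ˡ-injective R _ _
    }

  open Network network using (cutCost; Crosses; Separates; trace)

  bipartite : BipartiteByTerminals network
  bipartite e = inj₁ ((terminalOf e , refl) , λ (q , eq) →
    Fin.<⇒≢ (↑ˡ<↑ʳ q (centerOf e)) eq)

  crossing : (Fin k → Bool) → (Fin R → Bool) → Fin k → Fin R → ℕ
  crossing s b q y = if s q xor b y then edgeCost q y else 0

  onTerminals : Subset (k ℕ.+ R) → Fin k → Bool
  onTerminals W q = Vec.lookup W (q ↑ˡ R)

  onCenters : Subset (k ℕ.+ R) → Fin R → Bool
  onCenters W y = Vec.lookup W (k ↑ʳ y)

  seq-cutCost-network : ∀ W t → seq (cutCost W) t ≡
    ι (∑ℕ.sum λ q → ∑ℕ.sum (crossing (onTerminals W) (onCenters W) q))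
  seq-cutCost-network W t = begin
    seq (cutCost W) t
      ≡⟨ seq-cutCost network W t ⟩
    (∑ℚ.sum λ e → if Crosses W e then ι (edgeCost (terminalOf e) (centerOf e)) else 0ℚ)
      ≡⟨ ∑ℚ.sum-cong-≗ (λ e → ι-if (Crosses W e) (edgeCost (terminalOf e) (centerOf e))) ⟨
    (∑ℚ.sum λ e → ι (cross (terminalOf e) (centerOf e)))
      ≡⟨ ι-homo-sum (λ e → cross (terminalOf e) (centerOf e)) ⟨
    ι (∑ℕ.sum λ e → cross (terminalOf e) (centerOf e))
      ≡⟨ cong ι (∑ℕ.sum-combine k (λ e → cross (terminalOf e) (centerOf e))) ⟩
    ι (∑ℕ.sum λ q → ∑ℕ.sum λ y → cross (terminalOf (combine {k} {R} q y)) (centerOf (combine {k} {R} q y)))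
      ≡⟨ cong ι (∑ℕ.sum-cong-≗ {k} λ q → ∑ℕ.sum-cong-≗ {R} λ y →
           cong (λ (q , y) → cross q y) (Fin.remQuot-combine q y)) ⟩
    ι (∑ℕ.sum λ q → ∑ℕ.sum (cross q)) ∎
    where
    open ≡.≡-Reasoning
    cross : Fin k → Fin R → ℕ
    cross = crossing (onTerminals W) (onCenters W)

  starSum : (Fin k → Bool) → (Fin R → Bool) → ℕ
  starSum s b = ∑ℕ.sum λ y → weight y ℕ.* star s (b y) y

  -- No two centers are adjacent, so once the terminals are placed, each center contributes on its
  -- own and can be optimised separately.
  crossing-starSum : ∀ s b → (∑ℕ.sum λ q → ∑ℕ.sum (crossing s b q)) ≡ starSum s b
  crossing-starSum s b = begin
    (∑ℕ.sum λ q → ∑ℕ.sum λ y → crossing s b q y)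
      ≡⟨ ∑ℕ.∑-comm (crossing s b) ⟩
    (∑ℕ.sum λ y → ∑ℕ.sum λ q → crossing s b q y)
      ≡⟨ ∑ℕ.sum-cong-≗ {R} (λ y → ∑ℕ.sum-cong-≗ {k} λ q → if-* (s q xor b y) (weight y) (affinity y q)) ⟩
    (∑ℕ.sum λ y → ∑ℕ.sum λ q → weight y ℕ.* (if s q xor b y then affinity y q else 0))
      ≡⟨ ∑ℕ.sum-cong-≗ {R} (λ y → SemiringSum.*-distribˡ-sum ℕ.+-*-semiring (weight y)
           (λ q → if s q xor b y then affinity y q else 0)) ⟨
    starSum s b ∎
    where
    open ≡.≡-Reasoning
    if-* : ∀ b m n → (if b then m ℕ.* n else 0) ≡ m ℕ.* (if b then n else 0)
    if-* true  m n = refl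
    if-* false m n = sym (ℕ.*-zeroʳ m)

  starSum-cong : ∀ s b s′ b′ → (∀ q y → s q xor b y ≡ s′ q xor b′ y) → starSum s b ≡ starSum s′ b′
  starSum-cong s b s′ b′ h = ∑ℕ.sum-cong-≗ {R} λ y → cong (weight y ℕ.*_)
    (∑ℕ.sum-cong-≗ {k} λ q → cong (λ c → if c then affinity y q else 0) (h q y))

  mincutValue : Fin R → ℕ
  mincutValue x = starSum (inS x) (cheapSide x)

  mincutValue-≤ : ∀ x b → mincutValue x ℕ.≤ starSum (inS x) b
  mincutValue-≤ x b = sumℕ-mono-≤ λ y → ℕ.*-monoʳ-≤ (weight y) (star-min x y (b y))

  lookup-trace : ∀ {x W} → trace W ≡ x → ∀ q → Vec.lookup x q ≡ onTerminals W q
  lookup-trace {W = W} refl = Vec.lookup∘tabulate (onTerminals W)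

  lookup-S : ∀ x q → Vec.lookup (S x) q ≡ inS x q
  lookup-S x = Vec.lookup∘tabulate (inS x)

  separating-≥ : ∀ x W → Separates (S x) W → mincutValue x ℕ.≤
    starSum (onTerminals W) (onCenters W)
  separating-≥ x W (inj₁ e) = ℕ.≤-trans (mincutValue-≤ x (onCenters W)) (ℕ.≤-reflexive
    (starSum-cong (inS x) (onCenters W) (onTerminals W) (onCenters W) λ q y →
      cong (_xor onCenters W y) (trans (sym (lookup-S x q)) (lookup-trace {W = W} e q))))
  -- When W contains the complement of S x, negating the sides of all centers produces the same
  -- crossing edges with S x in its place.
  separating-≥ x W (inj₂ e) = ℕ.≤-trans (mincutValue-≤ x (not ∘ onCenters W)) (ℕ.≤-reflexive
    (starSum-cong (inS x) (not ∘ onCenters W) (onTerminals W) (onCenters W) λ q y →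
      trans (sym (not-xor (inS x q) (onCenters W y))) (cong (_xor onCenters W y)
        (trans (cong not (sym (lookup-S x q)))
        (trans (sym (Vec.lookup-map q not (S x))) (lookup-trace {W = W} e q))))))

  optimalCut : Fin R → Subset (k ℕ.+ R)
  optimalCut x = S x Vec.++ Vec.tabulate (cheapSide x)

  optimalCut-terminal : ∀ x q → onTerminals (optimalCut x) q ≡ inS x q
  optimalCut-terminal x q = trans (Vec.lookup-++ˡ (S x) _ q) (lookup-S x q)

  optimalCut-center : ∀ x y → onCenters (optimalCut x) y ≡ cheapSide x y
  optimalCut-center x y = trans (Vec.lookup-++ʳ (S x) _ y) (Vec.lookup∘tabulate (cheapSide x) y)

  seq-mincut-network : ∀ x t → seq (mincut network (S x)) t ≡ ι (mincutValue x)
  seq-mincut-network x t = ℚ.≤-antisym upper lower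
    where
    open ℚ.≤-Reasoning
    W* : Subset (k ℕ.+ R)
    W* = optimalCut x
    upper : seq (mincut network (S x)) t ℚ.≤ ι (mincutValue x)
    upper = begin
      seq (mincut network (S x)) t
        ≤⟨ mincut-≤ network {S x} {W*} t (inj₁ (Vec.tabulate-cong (optimalCut-terminal x))) ⟩
      seq (cutCost W*) t
        ≡⟨ seq-cutCost-network W* t ⟩
      ι (∑ℕ.sum λ q → ∑ℕ.sum (crossing (onTerminals W*) (onCenters W*) q))
        ≡⟨ cong ι (crossing-starSum (onTerminals W*) (onCenters W*)) ⟩
      ι (starSum (onTerminals W*) (onCenters W*))
        ≡⟨ cong ι (starSum-cong (onTerminals W*) (onCenters W*) (inS x) (cheapSide x) λ q y →
             cong₂ _xor_ (optimalCut-terminal x q) (optimalCut-center x y)) ⟩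
      ι (mincutValue x) ∎
    lower : ι (mincutValue x) ℚ.≤ seq (mincut network (S x)) t
    lower = let W , sep , e = mincut-attained network (S x) t in begin
      ι (mincutValue x)
        ≤⟨ ι-mono-≤ (separating-≥ x W sep) ⟩
      ι (starSum (onTerminals W) (onCenters W))
        ≡⟨ cong ι (crossing-starSum (onTerminals W) (onCenters W)) ⟨
      ι (∑ℕ.sum λ q → ∑ℕ.sum (crossing (onTerminals W) (onCenters W) q))
        ≡⟨ seq-cutCost-network W t ⟨
      seq (cutCost W) t
        ≡⟨ e ⟨
      seq (mincut network (S x)) t ∎

  -- The additive part of the minimum cuts.

  terminalWeight : Fin k → ℕ
  terminalWeight q = ∑ℕ.sum (edgeCost q)

  -- This is Λ(S x), the cost of the cut that has the terminals of S x alone on one side.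
  linearPart : Fin R → ℕ
  linearPart x = ∑ℕ.sum λ q → if inS x q then terminalWeight q else 0

  mincutValue-linearPart : ∀ x → linearPart x ≡ mincutValue x ℕ.+ weight x
  mincutValue-linearPart x = begin
    linearPart x
      ≡⟨ ∑ℕ.sum-cong-≗ {k} (λ q → trans (∑ℕ.if-sum (inS x q) (edgeCost q))
           (∑ℕ.sum-cong-≗ {R} λ y → cong (λ c → if c then edgeCost q y else 0) (sym (Bool.xor-identityʳ (inS x q))))) ⟩
    (∑ℕ.sum λ q → ∑ℕ.sum (crossing (inS x) (λ _ → false) q))
      ≡⟨ crossing-starSum (inS x) (λ _ → false) ⟩
    (∑ℕ.sum λ y → weight y ℕ.* star (inS x) false y)
      ≡⟨ ∑ℕ.sum-cong-≗ {R} (λ y → trans (cong (weight y ℕ.*_) (star-gap x y))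
           (trans (ℕ.*-distribˡ-+ (weight y) (star (inS x) (cheapSide x y) y) _)
             (cong (weight y ℕ.* star (inS x) (cheapSide x y) y ℕ.+_) (*-if (weight y) (cheapSide x y))))) ⟩
    (∑ℕ.sum λ y → weight y ℕ.* star (inS x) (cheapSide x y) y ℕ.+ (if cheapSide x y then weight y else 0))
      ≡⟨ ∑ℕ.∑-distrib-+ {R} _ _ ⟩
    mincutValue x ℕ.+ (∑ℕ.sum λ y → if cheapSide x y then weight y else 0)
      ≡⟨ cong (mincutValue x ℕ.+_) (∑ℕ.sum-indicator x weight) ⟩
    mincutValue x ℕ.+ weight x ∎
    where
    open ≡.≡-Reasoning
    *-if : ∀ m b → m ℕ.* (if b then 1 else 0) ≡ (if b then m else 0)
    *-if m true  = ℕ.*-identityʳ m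
    *-if m false = ℕ.*-zeroʳ m

  -- Exactly one of the terminals 0 and n, which encode the first digit and its negation, belongs to
  -- S x. Mimicking constrains only nonempty proper sets.
  S-nonempty : 0 ℕ.< n → ∀ x → Nonempty (S x) × Nonempty (∁ (S x))
  S-nonempty (s≤s {n = n-1} z≤n) x = go (digit n x zero) refl
    where
    i i′ : Fin k
    i  = zero ↑ˡ (n ℕ.+ t)
    i′ = n ↑ʳ (zero {n-1} ↑ˡ t)
    at : inS x i ≡ digit n x zero
    at = Vector.lookup-++ˡ (digit n x) (not ∘ digit n x ++ none) zero
    at′ : inS x i′ ≡ not (digit n x zero)
    at′ = trans (Vector.lookup-++ʳ (digit n x) (not ∘ digit n x ++ none) (zero ↑ˡ t))
      (Vector.lookup-++ˡ (not ∘ digit n x) none zero)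
    member : ∀ q → inS x q ≡ true → Nonempty (S x)
    member q h = q , Vec.lookup⇒[]= q (S x) (trans (lookup-S x q) h)
    nonmember : ∀ q → inS x q ≡ false → Nonempty (∁ (S x))
    nonmember q h = q , Vec.lookup⇒[]= q (∁ (S x)) (trans (Vec.lookup-map q not (S x))
      (cong not (trans (lookup-S x q) h)))
    go : ∀ b → digit n x zero ≡ b → Nonempty (S x) × Nonempty (∁ (S x))
    go true  e = member i (trans at e) , nonmember i′ (trans at′ (cong not e))
    go false e = member i′ (trans at′ (cong not e)) , nonmember i (trans at e)

  -- A lower bound on the number of edges of a mimicking network.

  module _ (0<n : 0 ℕ.< n) (N′ : Network k) (mimics : IsMimicking N′ network) where
    private module N′ = Network N′

    many-edges : 2 ℕ.^ R ℕ.≤ suc R ℕ.^ (k ℕ.+ N′.∣E∣)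
    many-edges = subsums-near-powers h c
      (λ x → ℚ.≤-trans (ℚ.≤-reflexive (row x)) (upper x))
      (λ x → ℚ.≤-trans (lower x) (ℚ.≤-reflexive (cong (ℚ._+ 1ℚ) (sym (row x)))))
      where
      open ℚ-Solver
      -- The finitely many x share one index T, and the tolerance 1 is the one that
      -- `subsums-near-powers` allows.
      close : Eventually λ t → ∀ x → ℚ.∣ seq (mincut N′ (S x)) t ℚ.- seq (mincut network (S x)) t ∣ ℚ.< 1ℚ
      close = eventually-all λ x → let p , q = S-nonempty 0<n x in mimics (S x) p q 1ℚ (ℚ.positive⁻¹ 1ℚ)
      T : ℕ
      T = proj₁ close
      value : Fin R → ℚ
      value x = seq (mincut N′ (S x)) T
      near : ∀ x → value x ℚ.≤ ι (mincutValue x) ℚ.+ 1ℚ × ι (mincutValue x) ℚ.≤ value x ℚ.+ 1ℚ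
      near x = ∣-∣<⇒≤ (subst (λ z → ℚ.∣ value x ℚ.- z ∣ ℚ.< 1ℚ) (seq-mincut-network x T) (proj₂ close T ℕ.≤-refl x))
      cut : Fin R → N′.Cut
      cut x = proj₁ (mincut-attained N′ (S x) T)
      c′ : Fin N′.∣E∣ → ℚ
      c′ e = seq (N′.cost e) T
      -- The columns are the k terminals, then the edges of N′ with negated costs. The row of x thus
      -- sums to Λ(S x) minus the cost at T of a minimum cut of N′.
      h : Fin R → Fin (k ℕ.+ N′.∣E∣) → Bool
      h x = inS x ++ N′.Crosses (cut x)
      c : Fin (k ℕ.+ N′.∣E∣) → ℚ
      c = ι ∘ terminalWeight ++ (ℚ.-_ ∘ c′)
      row : ∀ x → rowSum h c x ≡ ι (mincutValue x) ℚ.+ ι (weight x) ℚ.- value x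
      row x = trans (∑ℚ.sum-++ (λ b z → if b then z else 0ℚ) (inS x) (N′.Crosses (cut x)) (ι ∘ terminalWeight) (ℚ.-_ ∘ c′))
        (cong₂ ℚ._+_
          (trans (∑ℚ.sum-cong-≗ {k} λ q → sym (ι-if (inS x q) (terminalWeight q)))
          (trans (sym (ι-homo-sum {k} λ q → if inS x q then terminalWeight q else 0))
          (trans (cong ι (mincutValue-linearPart x)) (ι-homo-+ (mincutValue x) (weight x)))))
          (trans (sum-if-neg (N′.Crosses (cut x)) c′)
          (cong ℚ.-_ (sym (trans (proj₂ (proj₂ (mincut-attained N′ (S x) T))) (seq-cutCost N′ (cut x) T))))))
      upper : ∀ x → ι (mincutValue x) ℚ.+ ι (weight x) ℚ.- value x ℚ.≤ ι (weight x) ℚ.+ 1ℚ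
      upper x = ℚ.≤-trans
        (ℚ.+-monoˡ-≤ (ℚ.- value x) (ℚ.+-monoˡ-≤ (ι (weight x)) (proj₂ (near x))))
        (ℚ.≤-reflexive (solve 3 (λ v o w → v :+ o :+ w :- v := w :+ o) refl (value x) 1ℚ (ι (weight x))))
      lower : ∀ x → ι (weight x) ℚ.≤ ι (mincutValue x) ℚ.+ ι (weight x) ℚ.- value x ℚ.+ 1ℚ
      lower x = ℚ.≤-trans
        (ℚ.≤-reflexive (solve 2 (λ v w → w := v :+ (w :- v)) refl (value x) (ι (weight x))))
        (ℚ.≤-trans (ℚ.+-monoˡ-≤ (ι (weight x) ℚ.- value x) (proj₁ (near x)))
        (ℚ.≤-reflexive (solve 4 (λ f o w v → f :+ o :+ (w :- v) := f :+ w :- v :+ o) refl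
          (ι (mincutValue x)) 1ℚ (ι (weight x)) (value x))))

-- Size of mimicking networks

^-cancelʳ-≤ : ∀ m {n o} → 1 ℕ.< m → m ℕ.^ n ℕ.≤ m ℕ.^ o → n ℕ.≤ o
^-cancelʳ-≤ m 1<m h = ℕ.≮⇒≥ λ o<n → ℕ.<⇒≱ (ℕ.^-monoʳ-< m 1<m o<n) h

-- As 2^n + 1 ≤ 2^(n+1), both sides can be compared as powers of 2.
double-exponential-bound : ∀ n m → 2 ℕ.^ (2 ℕ.^ n) ℕ.≤ suc (2 ℕ.^ n) ℕ.^ m → 2 ℕ.^ n ℕ.≤ suc n ℕ.* m
double-exponential-bound n m h = ^-cancelʳ-≤ 2 (s≤s (s≤s z≤n)) (begin
  2 ℕ.^ (2 ℕ.^ n)             ≤⟨ h ⟩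
  suc (2 ℕ.^ n) ℕ.^ m         ≤⟨ ℕ.^-monoˡ-≤ m (ℕ.+-mono-≤ (ℕ.m^n>0 2 n) (ℕ.m≤m+n (2 ℕ.^ n) 0)) ⟩
  (2 ℕ.^ suc n) ℕ.^ m         ≡⟨ ℕ.^-*-assoc 2 (suc n) m ⟩
  2 ℕ.^ (suc n ℕ.* m)         ∎)
  where open ℕ.≤-Reasoning

-- The exponent 9 is 4 + 4 + 1: each factor 2^n is at most v^4, since (n + 1) m ≤ v (v + v^2), and
-- 2^t ≤ 4 ≤ v.
size-bound : ∀ n t v m → t ℕ.≤ 2 → suc n ℕ.≤ v → 4 ℕ.≤ v → m ℕ.≤ v ℕ.+ v ℕ.* v →
  2 ℕ.^ (2 ℕ.^ n) ℕ.≤ suc (2 ℕ.^ n) ℕ.^ m → 2 ℕ.^ (n ℕ.+ (n ℕ.+ t)) ℕ.≤ v ℕ.^ 9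
size-bound n t v m t≤2 n<v 4≤v m≤ h = begin
  2 ℕ.^ (n ℕ.+ (n ℕ.+ t))               ≡⟨ trans (ℕ.^-distribˡ-+-* 2 n (n ℕ.+ t)) (cong (2 ℕ.^ n ℕ.*_) (ℕ.^-distribˡ-+-* 2 n t)) ⟩
  2 ℕ.^ n ℕ.* (2 ℕ.^ n ℕ.* 2 ℕ.^ t)     ≤⟨ ℕ.*-mono-≤ 2^n≤v⁴ (ℕ.*-mono-≤ 2^n≤v⁴ (ℕ.≤-trans (ℕ.^-monoʳ-≤ 2 t≤2) 4≤v)) ⟩
  v ℕ.^ 4 ℕ.* (v ℕ.^ 4 ℕ.* v)           ≡⟨ cong (v ℕ.^ 4 ℕ.*_) (ℕ.*-comm (v ℕ.^ 4) v) ⟩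
  v ℕ.^ 4 ℕ.* v ℕ.^ 5                   ≡⟨ ℕ.^-distribˡ-+-* v 4 5 ⟨
  v ℕ.^ 9                               ∎
  where
  open ℕ.≤-Reasoning
  instance
    v≢0 : ℕ.NonZero v
    v≢0 = ℕ.>-nonZero (ℕ.≤-trans (s≤s z≤n) 4≤v)
  2^n≤v⁴ : 2 ℕ.^ n ℕ.≤ v ℕ.^ 4
  2^n≤v⁴ = begin
    2 ℕ.^ n                          ≤⟨ double-exponential-bound n m h ⟩
    suc n ℕ.* m                      ≤⟨ ℕ.*-mono-≤ n<v m≤ ⟩
    v ℕ.* (v ℕ.+ v ℕ.* v)            ≤⟨ ℕ.*-monoʳ-≤ v (ℕ.+-mono-≤ (ℕ.m≤m*n v v) (ℕ.m≤m+n (v ℕ.* v) 0)) ⟩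
    v ℕ.* (2 ℕ.* (v ℕ.* v))          ≤⟨ ℕ.*-monoʳ-≤ v (ℕ.*-monoˡ-≤ (v ℕ.* v) (ℕ.≤-trans (s≤s (s≤s z≤n)) 4≤v)) ⟩
    v ℕ.* (v ℕ.* (v ℕ.* v))          ≡⟨ cong (λ z → v ℕ.* (v ℕ.* (v ℕ.* z))) (ℕ.*-identityʳ v) ⟨
    v ℕ.^ 4                          ∎

-- The argument of `1/d` is one less than the denominator.
⅑ : ℝ
⅑ = fromℚ (1/d 8)

⅑-pos : 0ᴿ <ᴿ ⅑
⅑-pos = 1/d 8 , ℚ.positive⁻¹ (1/d 8) , 0 , λ _ _ → ℚ.≤-reflexive (ℚ.+-identityˡ (1/d 8))

HardNetwork : ℕ → Set
HardNetwork k = Σ[ N ∈ Network k ]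
  ((∀ (N′ : Network k) → IsMimicking N′ N → PowTwo≤ (k ·ᴿ ⅑) (Network.∣V∣ N′)) × BipartiteByTerminals N)

hardNetwork : ∀ n t (tail : Fin t → ℕ) → (∀ j → 0 ℕ.< tail j) → suc (∑ℕ.sum tail) ≡ n ℕ.* 2 →
  2 ℕ.≤ n → 1 ℕ.≤ t → t ℕ.≤ 2 → HardNetwork (n ℕ.+ (n ℕ.+ t))
hardNetwork n t tail tail-pos tail-sum 2≤n 1≤t t≤2 = network , large , bipartite
  where
  open Construction n t tail tail-pos tail-sum hiding (k)
  k : ℕ
  k = n ℕ.+ (n ℕ.+ t)
  large : ∀ N′ → IsMimicking N′ network → PowTwo≤ (k ·ᴿ ⅑) (Network.∣V∣ N′)
  large N′ mimics = 2^[k/d]≤ 8 k v {{ℕ.>-nonZero (ℕ.≤-trans (s≤s z≤n) 4≤v)}}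
    (size-bound n t v (k ℕ.+ Network.∣E∣ N′) t≤2
      (ℕ.≤-trans n<k (k≤∣V∣ N′)) 4≤v
      (ℕ.+-mono-≤ (k≤∣V∣ N′) (∣E∣≤∣V∣² N′))
      (many-edges (ℕ.≤-trans (s≤s z≤n) 2≤n) N′ mimics))
    where
    v : ℕ
    v = Network.∣V∣ N′
    4≤v : 4 ℕ.≤ v
    4≤v = ℕ.≤-trans (ℕ.+-mono-≤ 2≤n (ℕ.≤-trans 2≤n (ℕ.m≤m+n n t))) (k≤∣V∣ N′)
    n<k : n ℕ.< k
    n<k = ℕ.≤-trans (ℕ.≤-reflexive (ℕ.+-comm 1 n)) (ℕ.+-monoʳ-≤ n (ℕ.≤-trans 1≤t (ℕ.m≤n+m t n)))

-- Reaching every number of terminals.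

even-or-odd : ∀ n → (∃[ m ] n ≡ m ℕ.+ m) ⊎ (∃[ m ] n ≡ suc (m ℕ.+ m))
even-or-odd zero = inj₁ (0 , refl)
even-or-odd (suc n) with even-or-odd n
... | inj₁ (m , e) = inj₂ (m , cong suc e)
... | inj₂ (m , e) = inj₁ (suc m , cong suc (trans e (sym (ℕ.+-suc m m))))

hardNetwork-odd : ∀ m → HardNetwork (5 ℕ.+ (m ℕ.+ m))
hardNetwork-odd m = subst HardNetwork
  (solve 1 (λ m → con 2 :+ m :+ (con 2 :+ m :+ con 1) := con 5 :+ (m :+ m)) refl m)
  -- With n = m + 2, the single tail terminal carries the whole 2n - 1 = 3 + 2m.
  (hardNetwork (2 ℕ.+ m) 1 (λ _ → 3 ℕ.+ m ℕ.* 2) (λ _ → s≤s z≤n)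
    (cong (4 ℕ.+_) (ℕ.+-identityʳ (m ℕ.* 2))) (s≤s (s≤s z≤n)) (s≤s z≤n) (s≤s z≤n))
  where open ℕ-Solver

hardNetwork-even : ∀ m → HardNetwork (5 ℕ.+ suc (m ℕ.+ m))
hardNetwork-even m = subst HardNetwork
  (solve 1 (λ m → con 2 :+ m :+ (con 2 :+ m :+ con 2) := con 5 :+ (con 1 :+ (m :+ m))) refl m)
  (hardNetwork (2 ℕ.+ m) 2 tail tail-pos
    (cong (4 ℕ.+_) (ℕ.+-identityʳ (m ℕ.* 2))) (s≤s (s≤s z≤n)) (s≤s z≤n) (s≤s (s≤s z≤n)))
  where
  open ℕ-Solver
  -- The required total 2n - 1, with n = m + 2, is split as 1 + (2n - 2) to make room for one more
  -- terminal.
  tail : Fin 2 → ℕ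
  tail zero    = 1
  tail (suc _) = 2 ℕ.+ m ℕ.* 2
  tail-pos : ∀ j → 0 ℕ.< tail j
  tail-pos zero    = s≤s z≤n
  tail-pos (suc _) = s≤s z≤n

hardNetwork-≥5 : ∀ j → HardNetwork (5 ℕ.+ j)
hardNetwork-≥5 j = [ (λ (m , e) → subst (λ j → HardNetwork (5 ℕ.+ j)) (sym e) (hardNetwork-odd m))
                   , (λ (m , e) → subst (λ j → HardNetwork (5 ℕ.+ j)) (sym e) (hardNetwork-even m))
                   ]′ (even-or-odd j)

theorem1p2 : Σ[ α ∈ ℝ ] (0ᴿ <ᴿ α ×
    (∀ (k : ℕ) → k > 5 →
    Σ[ N ∈ Network k ]
    ((∀ (N′ : Network k) → IsMimicking N′ N → PowTwo≤ (k ·ᴿ α) (Network.∣V∣ N′))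
    × BipartiteByTerminals N)))
theorem1p2 = ⅑ , ⅑-pos , λ k k>5 →
  subst HardNetwork (ℕ.m+[n∸m]≡n (ℕ.<⇒≤ k>5)) (hardNetwork-≥5 (k ℕ.∸ 5))
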